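{- The group $\mathbb Z_3^8$ is not a CI-group. Moreover, no group containing a subgroup isomorphic to $\mathbb Z_3^8$ is a CI-group. In particular, $\mathbb Z_3^n$ is not a CI-group for any $n \ge 8$.
   Context: For a group $G$ and a subset $S\subseteq G$ with $S=S^{ -1}$, the Cayley graph $\mathrm{Cay}(G,S)$ is the undirected graph with vertex set $G$ in which $g$ and $h$ are adjacent if and only if $hg^{ -1}\in S$. The Cayley graph $\mathrm{Cay}(G,S)$ has the CI (Cayley Isomorphism) property if for every Cayley graph $\mathrm{Cay}(G,T)$ (with $T=T^{ -1}\subseteq G$) that is isomorphic to $\mathrm{Cay}(G,S)$ as a graph, there is a group automorphism $\alpha$ of $G$ such that $S^\alpha=T$, where $S^\alpha$ denotes the image of $S$ under $\alpha$. A group $G$ is a CI-group if every Cayley graph on $G$ (with undirected edges, i.e. with $S=S^{ -1}$) has the CI property. -}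

module Defs where

open import Algebra.Bundles using (Group; RawGroup)
open import Algebra.Morphism.Structures using (module GroupMorphisms)
import Algebra.Construct.Pointwise as Pointwise
import Algebra.Properties.Group as GroupProperties
open import Data.Fin.Base using (Fin; zero; toℕ)
open import Data.Fin.Properties using (all?; _≟_)
open import Data.Nat.Base using (ℕ; _+_; _∸_)
open import Data.Nat.DivMod using (_mod_)
open import Data.Product.Base using (Σ; ∃; ∃-syntax; _×_; _,_; proj₁; proj₂)
open import Function.Base using (_on_)
open import Function.Bundles using (Inverse; _⇔_)
open import Level using (Level; _⊔_; 0ℓ; suc)
open import Relation.Binary.Bundles using (Setoid)
open import Relation.Binary.Core using (Rel)
open import Relation.Binary.Definitions using (Symmetric; _Respects_; _Respects₂_)
open import Relation.Binary.PropositionalEquality.Core using (_≡_; refl; cong; cong₂)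
open import Relation.Binary.PropositionalEquality.Properties as ≡ using (isEquivalence)
open import Relation.Nullary.Decidable using (from-yes)
open import Relation.Unary using (Pred; _∈_; _≐_)

private
  variable
    a b c ℓ : Level

-- Undirected graphs; a loop at a vertex is allowed, so that a connection set
-- may contain the identity.

record Graph c ℓ r : Set (suc (c ⊔ ℓ ⊔ r)) where
  field
    vertices : Setoid c ℓ
  open Setoid vertices public using (_≈_) renaming (Carrier to Vertex)
  field
    Adjacent   : Rel Vertex r
    respects   : Adjacent Respects₂ _≈_
    undirected : Symmetric Adjacent

record _≅_ {c ℓ r} (Γ Δ : Graph c ℓ r) : Set (c ⊔ ℓ ⊔ r) where
  private
    module Γ = Graph Γ
    module Δ = Graph Δ
  field
    bijection : Inverse Γ.vertices Δ.vertices
  open Inverse bijection public using (to; from)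
  field
    adjacency : ∀ u v → Γ.Adjacent u v ⇔ Δ.Adjacent (to u) (to v)

module _ (G : Group c ℓ) where
  open Group G
  open GroupProperties G using (⁻¹-involutive; ⁻¹-anti-homo-∙)
  open GroupMorphisms rawGroup rawGroup using (IsGroupIsomorphism)

  image : (Carrier → Carrier) → Pred Carrier (c ⊔ ℓ) → Pred Carrier (c ⊔ ℓ)
  image f S y = ∃[ x ] x ∈ S × f x ≈ y

  record ConnectionSet : Set (suc (c ⊔ ℓ)) where
    field
      set            : Pred Carrier (c ⊔ ℓ)
      respects       : set Respects _≈_
      inverse-closed : set ≐ image _⁻¹ set

  open ConnectionSet using (set)

  Cay : ConnectionSet → Graph c ℓ (c ⊔ ℓ)
  Cay S = record
    { vertices   = setoid
    ; Adjacent   = λ g h → h ∙ g ⁻¹ ∈ S.set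
    ; respects   = (λ h≈h′ → S.respects (∙-congʳ h≈h′))
                 , (λ g≈g′ → S.respects (∙-congˡ (⁻¹-cong g≈g′)))
    ; undirected = λ {g} {h} hg⁻¹∈S → proj₂ S.inverse-closed
        ( h ∙ g ⁻¹ , hg⁻¹∈S
        , trans (⁻¹-anti-homo-∙ h (g ⁻¹)) (∙-congʳ (⁻¹-involutive g)))
    }
    where module S = ConnectionSet S

  HasCIProperty : ConnectionSet → Set (suc (c ⊔ ℓ))
  HasCIProperty S = ∀ T → Cay T ≅ Cay S →
    ∃[ α ] IsGroupIsomorphism α × image α (set S) ≐ set T

  IsCIGroup : Set (suc (c ⊔ ℓ))
  IsCIGroup = ∀ S → HasCIProperty S

  record Subgroup : Set (suc (c ⊔ ℓ)) where
    field
      member    : Pred Carrier (c ⊔ ℓ)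
      respects  : member Respects _≈_
      ε-closed  : ε ∈ member
      ∙-closed  : ∀ {x y} → x ∈ member → y ∈ member → x ∙ y ∈ member
      ⁻¹-closed : ∀ {x} → x ∈ member → x ⁻¹ ∈ member

    asRawGroup : RawGroup (c ⊔ ℓ) ℓ
    asRawGroup = record
      { Carrier = Σ Carrier member
      ; _≈_     = _≈_ on proj₁
      ; _∙_     = λ (x , x∈H) (y , y∈H) → x ∙ y , ∙-closed x∈H y∈H
      ; ε       = ε , ε-closed
      ; _⁻¹     = λ (x , x∈H) → x ⁻¹ , ⁻¹-closed x∈H
      }

  IsFinite : Set (c ⊔ ℓ)
  IsFinite = ∃[ n ] Inverse (setoid) (≡.setoid (Fin n))

HasSubgroupIsomorphicTo : Group a b → Group c ℓ → Set _
HasSubgroupIsomorphicTo K G = ∃ λ (H : Subgroup G) → ∃ λ f →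
  GroupMorphisms.IsGroupIsomorphism (Group.rawGroup K) (Subgroup.asRawGroup H) f

-- Every equivalence relation has a system of representatives.  For infinite G
-- this supplies representatives of the cosets of a subgroup.  Applied to
-- two-element types it also yields excluded middle.

AxiomOfChoice : ∀ c ℓ → Set (suc (c ⊔ ℓ))
AxiomOfChoice c ℓ = (X : Setoid c ℓ) → let open Setoid X in
  ∃ λ (rep : Carrier → Carrier) →
    (∀ x → rep x ≈ x) × (∀ {x y} → x ≈ y → rep x ≡ rep y)

_+₃_ : Fin 3 → Fin 3 → Fin 3
i +₃ j = (toℕ i + toℕ j) mod 3

-₃_ : Fin 3 → Fin 3
-₃ i = (3 ∸ toℕ i) mod 3

ℤ₃ : Group 0ℓ 0ℓ
ℤ₃ = record
  { Carrier = Fin 3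
  ; _≈_     = _≡_
  ; _∙_     = _+₃_
  ; ε       = zero
  ; _⁻¹     = -₃_
  ; isGroup = record
    { isMonoid = record
      { isSemigroup = record
        { isMagma = record { isEquivalence = isEquivalence ; ∙-cong = cong₂ _+₃_ }
        ; assoc   = from-yes (all? λ i → all? λ j → all? λ k →
                      ((i +₃ j) +₃ k) ≟ (i +₃ (j +₃ k)))
        }
      ; identity = from-yes (all? λ i → (zero +₃ i) ≟ i)
                 , from-yes (all? λ i → (i +₃ zero) ≟ i)
      }
    ; inverse = from-yes (all? λ i → ((-₃ i) +₃ i) ≟ zero)
              , from-yes (all? λ i → (i +₃ (-₃ i)) ≟ zero)
    ; ⁻¹-cong = cong -₃_
    }
  }

ℤ₃^_ : ℕ → Group 0ℓ 0ℓ
ℤ₃^ n = Pointwise.group (Fin n) ℤ₃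

{-# OPTIONS --safe #-}
module Submission where

-- Write ℤ₃⁸ as the sum of a base ℤ₃³ with points d = (p,q,s) and a fibre ℤ₃⁵, and
-- let the linear functional w(d) on the fibre have the coefficients (-sq, -sp,
-- q², pq, p²).  The cubic map g(d) = (p²q, pq², p²s, pqs, q²s) satisfies
-- w(d)·(g(a + d) - g(a)) = sp²q² for all a.  Hence v ↦ v - g(base v) is an
-- isomorphism of Cayley graphs from T = {d = 0 or w(d)·b ≠ sp²q²} to S = {d = 0
-- or w(d)·b ≠ 0}.  An automorphism β with β(S) = T preserves the fibre over 0,
-- since this fibre consists of those v for which u ∈ T always implies u + v ∈ T
-- or u - v ∈ T.  As (d,0) ∉ S for d ≠ 0, applying β to a suitable linear section
-- gives a linear map l with w(d)·l(d) = sp²q² for all d, which is impossible by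
-- comparing coefficients.
--
-- If K embeds in G, an isomorphism between Cayley graphs on K extends to G coset
-- by coset, and an automorphism of G mapping S onto T restricts to K when S and T
-- both generate K.

open import Defs
open import Algebra.Bundles using (Group; CommutativeRing)
open import Algebra.Morphism.Structures using (module GroupMorphisms)
import Algebra.Properties.Group as GroupProperties
import Algebra.Properties.Semiring.Sum as SemiringSum
open import Data.Fin.Base
  using (Fin; zero; suc; toℕ; finToFun; funToFin; splitAt; combine; _↑ˡ_; _↑ʳ_)
open import Data.Fin.Patterns
open import Data.Fin.Properties
  using (all?; any?; _≟_; funToFin-finToFin; finToFun-funToFin)
open import Data.Nat.Base using (zero; suc; _≥_; _+_; _∸_; _^_; _*_)
open import Data.Nat.DivMod using (_mod_)
open import Data.Nat.Properties using (m+[n∸m]≡n; ≤-refl)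
open import Data.Product.Base as Product using (∃; ∃-syntax; _×_; _,_; proj₁; proj₂)
open import Data.Sum.Base as Sum using (_⊎_; inj₁; inj₂; [_,_]′)
open import Data.Vec.Functional using (Vector; []; _∷_; _++_; take; drop)
open import Data.Vec.Functional.Properties using (lookup-++ˡ; lookup-++ʳ)
open import Function.Base using (id; _∘_)
open import Function.Bundles using (Inverse; Equivalence; _⇔_; mk⇔)
import Function.Consequences.Setoid as Consequences
open import Level using (0ℓ; Lift; lift; _⊔_)
open import Relation.Binary.Bundles using (Setoid)
open import Relation.Binary.Core using (Rel)
open import Relation.Binary.PropositionalEquality
  using (_≡_; _≢_; _≗_; refl; sym; trans; cong; cong₂; subst; module ≡-Reasoning)
import Relation.Binary.Reasoning.Setoid as SetoidReasoning
open import Relation.Nullary.Decidable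
  using (Dec; yes; no; True; toWitness; decidable-stable; map′; _×-dec_; _⊎-dec_; _→-dec_; ¬?)
open import Relation.Nullary.Negation.Core using (¬_; contradiction)
open import Relation.Unary using (Pred; Decidable; _∈_; _∉_; _⊆_; _≐_)

open ConnectionSet
open GroupMorphisms using (IsGroupMonomorphism; IsGroupIsomorphism)

-- Cayley graphs of overgroups

module _ {c ℓ} (G : Group c ℓ) where
  open Group G

  -- Only products are closed under: for an inverse-closed connection set they already give the
  -- generated subgroup.
  data ⟨_⟩ (S : Pred Carrier (c ⊔ ℓ)) : Pred Carrier (c ⊔ ℓ) where
    ε-gen : ε ∈ ⟨ S ⟩
    ∙-gen : ∀ {x y z} → x ∈ S → y ∈ ⟨ S ⟩ → x ∙ y ≈ z → z ∈ ⟨ S ⟩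

  Generates : ConnectionSet G → Set (c ⊔ ℓ)
  Generates S = ∀ x → x ∈ ⟨ set S ⟩

module Extension {c ℓ} (K : Group 0ℓ 0ℓ) (G : Group c ℓ)
  (f : Group.Carrier K → Group.Carrier G)
  (f-mono : IsGroupMonomorphism (Group.rawGroup K) (Group.rawGroup G) f)
  where

  private
    module K where
      open Group K public
      open GroupProperties K public
    module G where
      open Group G public
      open GroupProperties G public
    module f = GroupMorphisms.IsGroupMonomorphism f-mono
  open SetoidReasoning G.setoid

  infix 4 _∼_

  -- The classes are the right cosets f(K)x, matching the test `h ∙ g ⁻¹` for adjacency in `Cay`.
  _∼_ : Rel G.Carrier ℓ
  x ∼ y = ∃[ k ] f k G.∙ x G.≈ y

  ∼-reflexive : ∀ {x y} → x G.≈ y → x ∼ y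
  ∼-reflexive {x} x≈y = K.ε , G.trans (G.trans (G.∙-congʳ f.ε-homo) (G.identityˡ x)) x≈y

  ∼-sym : ∀ {x y} → x ∼ y → y ∼ x
  ∼-sym {x} {y} (k , fk∙x≈y) = k K.⁻¹ , (begin
    f (k K.⁻¹) G.∙ y            ≈⟨ G.∙-cong (f.⁻¹-homo k) (G.sym fk∙x≈y) ⟩
    f k G.⁻¹ G.∙ (f k G.∙ x)    ≈⟨ G.\\-leftDividesʳ (f k) x ⟩
    x                           ∎)

  ∼-trans : ∀ {x y z} → x ∼ y → y ∼ z → x ∼ z
  ∼-trans {x} {y} {z} (j , fj∙x≈y) (k , fk∙y≈z) = k K.∙ j , (begin
    f (k K.∙ j) G.∙ x      ≈⟨ G.∙-congʳ (f.∙-homo k j) ⟩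
    f k G.∙ f j G.∙ x      ≈⟨ G.assoc (f k) (f j) x ⟩
    f k G.∙ (f j G.∙ x)    ≈⟨ G.∙-congˡ fj∙x≈y ⟩
    f k G.∙ y              ≈⟨ fk∙y≈z ⟩
    z                      ∎)

  cosets : Setoid c ℓ
  cosets = record
    { Carrier = G.Carrier
    ; _≈_ = _∼_
    ; isEquivalence = record
      { refl = ∼-reflexive G.refl ; sym = ∼-sym ; trans = ∼-trans }
    }

  IsTransversal : (G.Carrier → G.Carrier) → Set _
  IsTransversal rep = (∀ x → rep x ∼ x) × (∀ {x y} → x ∼ y → rep x G.≈ rep y)

  pushforward : ConnectionSet K → ConnectionSet G
  pushforward S = record
    { set = λ y → Lift c (∃[ k ] k ∈ set S × f k G.≈ y)
    ; respects = λ { x≈y (lift (k , k∈S , fk≈x)) → lift (k , k∈S , G.trans fk≈x x≈y) }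
    ; inverse-closed =
        (λ { {y} (lift (k , k∈S , fk≈y)) →
          let j , j∈S , j⁻¹≈k = proj₁ (inverse-closed S) k∈S in
          f j , lift (j , j∈S , G.refl) ,
          G.trans (G.sym (f.⁻¹-homo j)) (G.trans (f.⟦⟧-cong j⁻¹≈k) fk≈y) })
      , (λ { (x , lift (k , k∈S , fk≈x) , x⁻¹≈y) →
          lift (k K.⁻¹ , proj₂ (inverse-closed S) (k , k∈S , K.refl) ,
            G.trans (f.⁻¹-homo k) (G.trans (G.⁻¹-cong fk≈x) x⁻¹≈y)) })
    }

  ∈-pushforward : ∀ S {k y} → f k G.≈ y → y ∈ set (pushforward S) → k ∈ set S
  ∈-pushforward S fk≈y (lift (j , j∈S , fj≈y)) =
    respects S (f.injective (G.trans fj≈y (G.sym fk≈y))) j∈S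

  -- Edges stay inside right cosets of f(K), so the graph on G splits into copies of the one on `K`.
  pushforward⇒∼ : ∀ S {x y} → y G.∙ x G.⁻¹ ∈ set (pushforward S) → x ∼ y
  pushforward⇒∼ S {x} {y} (lift (k , _ , fk≈yx⁻¹)) =
    k , G.trans (G.∙-congʳ fk≈yx⁻¹) (G.//-rightDividesˡ x y)

  module _ (rep : G.Carrier → G.Carrier) (transversal : IsTransversal rep) where

    rep-cong : ∀ {x y} → x ∼ y → rep x G.≈ rep y
    rep-cong = proj₂ transversal

    part : G.Carrier → K.Carrier
    part x = proj₁ (proj₁ transversal x)

    part-rep : ∀ x → f (part x) G.∙ rep x G.≈ x
    part-rep x = proj₂ (proj₁ transversal x)

    part-unique : ∀ {x k} → f k G.∙ rep x G.≈ x → part x K.≈ k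
    part-unique {x} fk∙rep≈x =
      f.injective (G.∙-cancelʳ (rep x) _ _ (G.trans (part-rep x) (G.sym fk∙rep≈x)))

    part-cong : ∀ {x y} → x G.≈ y → part x K.≈ part y
    part-cong {x} {y} x≈y = part-unique
      (G.trans (G.∙-congˡ (rep-cong (∼-reflexive x≈y))) (G.trans (part-rep y) (G.sym x≈y)))

    -- Each `x` is f(k) times its representative for a unique k; the same φ acts on k in every
    -- coset.
    cosetwise : (K.Carrier → K.Carrier) → G.Carrier → G.Carrier
    cosetwise φ x = f (φ (part x)) G.∙ rep x

    cosetwise-∼ : ∀ φ x → x ∼ cosetwise φ x
    cosetwise-∼ φ x = ∼-trans (∼-sym (part x , part-rep x)) (φ (part x) , G.refl)

    cosetwise-cong : ∀ {φ} → (∀ {j k} → j K.≈ k → φ j K.≈ φ k) →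
                     ∀ {x y} → x G.≈ y → cosetwise φ x G.≈ cosetwise φ y
    cosetwise-cong φ-cong x≈y =
      G.∙-cong (f.⟦⟧-cong (φ-cong (part-cong x≈y))) (rep-cong (∼-reflexive x≈y))

    part-cosetwise : ∀ φ x → part (cosetwise φ x) K.≈ φ (part x)
    part-cosetwise φ x = part-unique (G.∙-congˡ (rep-cong (∼-sym (cosetwise-∼ φ x))))

    cosetwise-inverse : ∀ {φ ψ} → (∀ {j k} → j K.≈ ψ k → φ j K.≈ k) →
                        ∀ x → cosetwise φ (cosetwise ψ x) G.≈ x
    cosetwise-inverse {φ} {ψ} φψ≈id x = begin
      f (φ (part (cosetwise ψ x))) G.∙ rep (cosetwise ψ x)
        ≈⟨ G.∙-cong (f.⟦⟧-cong (φψ≈id (part-cosetwise ψ x))) (rep-cong (∼-sym (cosetwise-∼ ψ x))) ⟩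
      f (part x) G.∙ rep x
        ≈⟨ part-rep x ⟩
      x ∎

    -- The common representative cancels, so adjacency within a coset depends only on the parts in
    -- `K`.
    same-coset-quotient : ∀ j k {x y} → rep x G.≈ rep y →
      (f k G.∙ rep y) G.∙ (f j G.∙ rep x) G.⁻¹ G.≈ f (k K.∙ j K.⁻¹)
    same-coset-quotient j k {x} {y} rx≈ry = begin
      (f k G.∙ rep y) G.∙ (f j G.∙ rep x) G.⁻¹
        ≈⟨ G.∙-congˡ (G.trans (G.⁻¹-cong (G.∙-congˡ rx≈ry)) (G.⁻¹-anti-homo-∙ (f j) (rep y))) ⟩
      (f k G.∙ rep y) G.∙ (rep y G.⁻¹ G.∙ f j G.⁻¹)
        ≈⟨ G.assoc _ _ _ ⟨
      f k G.∙ rep y G.∙ rep y G.⁻¹ G.∙ f j G.⁻¹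
        ≈⟨ G.∙-congʳ (G.//-rightDividesʳ (rep y) (f k)) ⟩
      f k G.∙ f j G.⁻¹
        ≈⟨ G.∙-congˡ (f.⁻¹-homo j) ⟨
      f k G.∙ f (j K.⁻¹)
        ≈⟨ f.∙-homo k (j K.⁻¹) ⟨
      f (k K.∙ j K.⁻¹) ∎

    part-quotient : ∀ {x y} → x ∼ y → f (part y K.∙ part x K.⁻¹) G.≈ y G.∙ x G.⁻¹
    part-quotient {x} {y} x∼y = G.trans
      (G.sym (same-coset-quotient (part x) (part y) (rep-cong x∼y)))
      (G.∙-cong (part-rep y) (G.⁻¹-cong (part-rep x)))

    cosetwise-≅ : ∀ {S T} → Cay K T ≅ Cay K S → Cay G (pushforward T) ≅ Cay G (pushforward S)
    cosetwise-≅ {S} {T} T≅S = record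
      { bijection = record
        { to        = cosetwise φ.to
        ; from      = cosetwise φ.from
        ; to-cong   = cosetwise-cong φ.to-cong
        ; from-cong = cosetwise-cong φ.from-cong
        ; inverse   =
            Consequences.strictlyInverseˡ⇒inverseˡ G.setoid G.setoid
              (cosetwise-cong φ.to-cong) (cosetwise-inverse φ.inverseˡ)
          , Consequences.strictlyInverseʳ⇒inverseʳ G.setoid G.setoid
              (cosetwise-cong φ.from-cong) (cosetwise-inverse φ.inverseʳ)
        }
      ; adjacency = λ x y →
          let module adj = Equivalence (_≅_.adjacency T≅S (part x) (part y))
              quotient : x ∼ y → f (φ.to (part y) K.∙ φ.to (part x) K.⁻¹)
                                 G.≈ cosetwise φ.to y G.∙ cosetwise φ.to x G.⁻¹
              quotient x∼y = G.sym (same-coset-quotient (φ.to (part x)) (φ.to (part y)) (rep-cong x∼y))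
          in mk⇔
            (λ yx⁻¹∈T → let x∼y = pushforward⇒∼ T yx⁻¹∈T in
              lift (_ , adj.to (∈-pushforward T (part-quotient x∼y) yx⁻¹∈T) , quotient x∼y))
            (λ yx⁻¹∈S →
              -- `cosetwise` never leaves a coset, so an edge between the images puts `x` and `y`
              -- into one coset.
              let x∼y = ∼-trans (cosetwise-∼ φ.to x)
                          (∼-trans (pushforward⇒∼ S yx⁻¹∈S) (∼-sym (cosetwise-∼ φ.to y)))
              in lift (_ , adj.from (∈-pushforward S (quotient x∼y) yx⁻¹∈S) , part-quotient x∼y))
      }
      where module φ = Inverse (_≅_.bijection T≅S)

  -- Such an α maps f(K), the subgroup generated by f(S), onto the one generated by
  -- f(T), which is f(K) again.
  restrict : ∀ {S T} → Generates K S → Generates K T →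
    ∀ {α} → IsGroupIsomorphism G.rawGroup G.rawGroup α →
    image G α (set (pushforward S)) ≐ set (pushforward T) →
    ∃[ β ] IsGroupIsomorphism K.rawGroup K.rawGroup β × image K β (set S) ≐ set T
  restrict {S} {T} gen-S gen-T {α} α-iso (αS⊆T , T⊆αS) = β , β-iso , βS⊆T , T⊆βS
    where
    module α = GroupMorphisms.IsGroupIsomorphism α-iso

    onto-f : ∀ {x} → x ∈ ⟨_⟩ K (set S) → ∃[ y ] f y G.≈ α (f x)
    onto-f ε-gen = K.ε , (begin
      f K.ε        ≈⟨ f.ε-homo ⟩
      G.ε          ≈⟨ α.ε-homo ⟨
      α G.ε        ≈⟨ α.⟦⟧-cong f.ε-homo ⟨
      α (f K.ε)    ∎)
    onto-f (∙-gen {s} {x} {z} s∈S x∈⟨S⟩ sx≈z) =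
      let lift (t , _ , ft≈αfs) = αS⊆T (f s , lift (s , s∈S , G.refl) , G.refl)
          y , fy≈αfx = onto-f x∈⟨S⟩
      in t K.∙ y , (begin
        f (t K.∙ y)            ≈⟨ f.∙-homo t y ⟩
        f t G.∙ f y            ≈⟨ G.∙-cong ft≈αfs fy≈αfx ⟩
        α (f s) G.∙ α (f x)    ≈⟨ α.∙-homo (f s) (f x) ⟨
        α (f s G.∙ f x)        ≈⟨ α.⟦⟧-cong (f.∙-homo s x) ⟨
        α (f (s K.∙ x))        ≈⟨ α.⟦⟧-cong (f.⟦⟧-cong sx≈z) ⟩
        α (f z)                ∎)

    -- `β` is α conjugated by f; injectivity of f turns each law of α into one of `β`.
    β : K.Carrier → K.Carrier
    β x = proj₁ (onto-f (gen-S x))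

    f-β : ∀ x → f (β x) G.≈ α (f x)
    f-β x = proj₂ (onto-f (gen-S x))

    β-homo : ∀ x y → β (x K.∙ y) K.≈ β x K.∙ β y
    β-homo x y = f.injective (begin
      f (β (x K.∙ y))        ≈⟨ f-β (x K.∙ y) ⟩
      α (f (x K.∙ y))        ≈⟨ α.⟦⟧-cong (f.∙-homo x y) ⟩
      α (f x G.∙ f y)        ≈⟨ α.∙-homo (f x) (f y) ⟩
      α (f x) G.∙ α (f y)    ≈⟨ G.∙-cong (f-β x) (f-β y) ⟨
      f (β x) G.∙ f (β y)    ≈⟨ f.∙-homo (β x) (β y) ⟨
      f (β x K.∙ β y)        ∎)

    β-cong : ∀ {x y} → x K.≈ y → β x K.≈ β y
    β-cong {x} {y} x≈y = f.injective
      (G.trans (f-β x) (G.trans (α.⟦⟧-cong (f.⟦⟧-cong x≈y)) (G.sym (f-β y))))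

    β-ε : β K.ε K.≈ K.ε
    β-ε = K.identityˡ-unique (β K.ε) (β K.ε)
      (K.trans (K.sym (β-homo K.ε K.ε)) (β-cong (K.identityˡ K.ε)))

    T⊆βS : ∀ {t} → t ∈ set T → t ∈ image K β (set S)
    T⊆βS {t} t∈T =
      let x , lift (s , s∈S , fs≈x) , αx≈ft = T⊆αS (lift (t , t∈T , G.refl))
      in s , s∈S , f.injective (G.trans (f-β s) (G.trans (α.⟦⟧-cong fs≈x) αx≈ft))

    -- The image of `β` is closed under products and contains `T`, which generates `K`.
    onto-β : ∀ {y} → y ∈ ⟨_⟩ K (set T) → ∃[ x ] β x K.≈ y
    onto-β ε-gen = K.ε , β-ε
    onto-β (∙-gen {t} {y} t∈T y∈⟨T⟩ ty≈z) =
      let s , _ , βs≈t = T⊆βS t∈T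
          x , βx≈y = onto-β y∈⟨T⟩
      in s K.∙ x , K.trans (β-homo s x) (K.trans (K.∙-cong βs≈t βx≈y) ty≈z)

    βS⊆T : ∀ {t} → t ∈ image K β (set S) → t ∈ set T
    βS⊆T {t} (s , s∈S , βs≈t) = ∈-pushforward T G.refl
      (αS⊆T (f s , lift (s , s∈S , G.refl) , G.trans (G.sym (f-β s)) (f.⟦⟧-cong βs≈t)))

    β-iso : IsGroupIsomorphism K.rawGroup K.rawGroup β
    β-iso = record
      { isGroupMonomorphism = record
        { isGroupHomomorphism = record
          { isMonoidHomomorphism = record
            { isMagmaHomomorphism = record
              { isRelHomomorphism = record { cong = β-cong }
              ; homo = β-homo
              }
            ; ε-homo = β-ε
            }
          ; ⁻¹-homo = λ x → K.inverseˡ-unique _ _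
              (K.trans (K.sym (β-homo (x K.⁻¹) x)) (K.trans (β-cong (K.inverseˡ x)) β-ε))
          }
        ; injective = λ {x} {y} βx≈βy → f.injective (α.injective
            (G.trans (G.sym (f-β x)) (G.trans (f.⟦⟧-cong βx≈βy) (f-β y))))
        }
      ; surjective = λ y → let x , βx≈y = onto-β (gen-T y) in
          x , λ z≈x → K.trans (β-cong z≈x) βx≈y
      }

  CI-restriction : ∀ {rep} → IsTransversal rep → IsCIGroup G →
    ∀ {S T} → Generates K S → Generates K T → Cay K T ≅ Cay K S →
    ∃[ β ] IsGroupIsomorphism K.rawGroup K.rawGroup β × image K β (set S) ≐ set T
  CI-restriction {rep} transversal ci {S} {T} gen-S gen-T T≅S =
    let α , α-iso , αS≐T =
          ci (pushforward S) (pushforward T) (cosetwise-≅ rep transversal {S} {T} T≅S)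
    in restrict {S} {T} gen-S gen-T α-iso αS≐T

-- The two Cayley graphs on ℤ₃⁸

-- Identities over 𝔽₃ are settled by evaluating all cases, which is why later proofs pass from
-- vectors to explicit coordinates.
decide : ∀ {a} {A : Set a} (A? : Dec A) {_ : True A?} → A
decide _ {t} = toWitness t

-- Above 20, the default precedence at which _+₃_ binds.
infixl 30 _*₃_

_*₃_ : Fin 3 → Fin 3 → Fin 3
i *₃ j = (toℕ i * toℕ j) mod 3

𝔽₃ : CommutativeRing 0ℓ 0ℓ
𝔽₃ = record
  { Carrier = Fin 3
  ; _≈_ = _≡_
  ; _+_ = _+₃_
  ; _*_ = _*₃_
  ; -_ = -₃_
  ; 0# = 0F
  ; 1# = 1F
  ; isCommutativeRing = record
    { isRing = record
      { +-isAbelianGroup = record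
        { isGroup = Group.isGroup ℤ₃
        ; comm = decide (all? λ i → all? λ j → _ ≟ _)
        }
      ; *-cong = cong₂ _*₃_
      ; *-assoc = decide (all? λ i → all? λ j → all? λ k → _ ≟ _)
      ; *-identity = decide (all? λ i → _ ≟ _) , decide (all? λ i → _ ≟ _)
      ; distrib = decide (all? λ i → all? λ j → all? λ k → _ ≟ _)
                , decide (all? λ i → all? λ j → all? λ k → _ ≟ _)
      }
    ; *-comm = decide (all? λ i → all? λ j → _ ≟ _)
    }
  }

private
  module 𝔽 where
    open CommutativeRing 𝔽₃ public
    open GroupProperties ℤ₃ public
  module V = Group (ℤ₃^ 8)
  module VP = GroupProperties (ℤ₃^ 8)

open SemiringSum 𝔽.semiring
  using (sum; sum-cong-≗; ∑-distrib-+; ∑-comm; *-distribˡ-sum; sum-replicate-zero)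

-- Weights, pairings and the cubic identity.

0⃗ : ∀ {n} → Vector (Fin 3) n
0⃗ _ = 0F

-- The weights are quadratic forms in d, so pairing d (l d) is a cubic form for
-- every linear map l, whereas twist has degree 5.
weight : Vector (Fin 3) 3 → Vector (Fin 3) 5
weight d = -₃ (s *₃ q) ∷ -₃ (s *₃ p) ∷ q *₃ q ∷ p *₃ q ∷ p *₃ p ∷ []
  where p = d 0F; q = d 1F; s = d 2F

pairing : Vector (Fin 3) 3 → Vector (Fin 3) 5 → Fin 3
pairing d b = sum (λ i → weight d i *₃ b i)

twist : Vector (Fin 3) 3 → Fin 3
twist d = d 2F *₃ ((d 0F *₃ d 0F) *₃ (d 1F *₃ d 1F))

cubics : Vector (Fin 3) 3 → Vector (Fin 3) 5
cubics d = p *₃ p *₃ q ∷ p *₃ q *₃ q ∷ p *₃ p *₃ s ∷ p *₃ q *₃ s ∷ q *₃ q *₃ s ∷ []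
  where p = d 0F; q = d 1F; s = d 2F

weight-cong : ∀ d e → d ≗ e → weight d ≗ weight e
weight-cong d e eq 0F = cong -₃_ (cong₂ _*₃_ (eq 2F) (eq 1F))
weight-cong d e eq 1F = cong -₃_ (cong₂ _*₃_ (eq 2F) (eq 0F))
weight-cong d e eq 2F = cong₂ _*₃_ (eq 1F) (eq 1F)
weight-cong d e eq 3F = cong₂ _*₃_ (eq 0F) (eq 1F)
weight-cong d e eq 4F = cong₂ _*₃_ (eq 0F) (eq 0F)

cubics-cong : ∀ {d e} → d ≗ e → cubics d ≗ cubics e
cubics-cong eq 0F = cong₂ _*₃_ (cong₂ _*₃_ (eq 0F) (eq 0F)) (eq 1F)
cubics-cong eq 1F = cong₂ _*₃_ (cong₂ _*₃_ (eq 0F) (eq 1F)) (eq 1F)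
cubics-cong eq 2F = cong₂ _*₃_ (cong₂ _*₃_ (eq 0F) (eq 0F)) (eq 2F)
cubics-cong eq 3F = cong₂ _*₃_ (cong₂ _*₃_ (eq 0F) (eq 1F)) (eq 2F)
cubics-cong eq 4F = cong₂ _*₃_ (cong₂ _*₃_ (eq 1F) (eq 1F)) (eq 2F)

twist-cong : ∀ {d e} → d ≗ e → twist d ≡ twist e
twist-cong eq =
  cong₂ _*₃_ (eq 2F) (cong₂ _*₃_ (cong₂ _*₃_ (eq 0F) (eq 0F)) (cong₂ _*₃_ (eq 1F) (eq 1F)))

pairing-cong : ∀ d e {b c} → d ≗ e → b ≗ c → pairing d b ≡ pairing e c
pairing-cong d e d≗e b≗c = sum-cong-≗ (λ i → cong₂ _*₃_ (weight-cong d e d≗e i) (b≗c i))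

pairing-+ : ∀ d b c → pairing d (λ i → b i +₃ c i) ≡ pairing d b +₃ pairing d c
pairing-+ d b c = trans
  (sum-cong-≗ (λ i → 𝔽.distribˡ (weight d i) (b i) (c i)))
  (∑-distrib-+ (λ i → weight d i *₃ b i) (λ i → weight d i *₃ c i))

pairing-zero : ∀ d {b} → b ≗ 0⃗ → pairing d b ≡ 0F
pairing-zero d b≗0 = trans
  (sum-cong-≗ (λ i → trans (cong (weight d i *₃_) (b≗0 i)) (𝔽.zeroʳ (weight d i))))
  (sum-replicate-zero 5)

pairing-neg : ∀ d b → pairing d (λ i → -₃ b i) ≡ -₃ pairing d b
pairing-neg d b = 𝔽.inverseˡ-unique _ _ (trans
  (sym (pairing-+ d (λ i → -₃ b i) b))
  (pairing-zero d (λ i → 𝔽.-‿inverseˡ (b i))))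

-- Let (p,q,s) = d - e and expand the cubics around e. The terms free of e contribute
-- (-1-1+1+1+1)sp²q² = sp²q²; the others cancel, some only because 3 = 0.
pairing-cubics : ∀ d e → let d-e = λ i → d i +₃ (-₃ e i) in
  pairing d-e (λ j → cubics d j +₃ (-₃ cubics e j)) ≡ twist d-e
pairing-cubics d e = cases (d 0F) (d 1F) (d 2F) (e 0F) (e 1F) (e 2F)
  where
  cases : ∀ p q s p′ q′ s′ →
    let d = p ∷ q ∷ s ∷ []; e = p′ ∷ q′ ∷ s′ ∷ []; d-e = λ i → d i +₃ (-₃ e i) in
    pairing d-e (λ j → cubics d j +₃ (-₃ cubics e j)) ≡ twist d-e
  cases = decide (all? λ p → all? λ q → all? λ s → all? λ p′ → all? λ q′ → all? λ s′ → _ ≟ _)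

-- Each weight has a factor p or q.
weight-degenerate : ∀ d → d 0F ≡ 0F → d 1F ≡ 0F → weight d ≗ 0⃗
weight-degenerate d p≡0 q≡0 j =
  trans (weight-cong d (0F ∷ 0F ∷ d 2F ∷ []) (λ { 0F → p≡0 ; 1F → q≡0 ; 2F → refl }) j)
    (cases (d 2F) j)
  where
  cases : ∀ s → weight (0F ∷ 0F ∷ s ∷ []) ≗ 0⃗
  cases = decide (all? λ s → all? λ j → _ ≟ _)

pairing-degenerate : ∀ d b → d 0F ≡ 0F → d 1F ≡ 0F → pairing d b ≡ 0F
pairing-degenerate d b p≡0 q≡0 = trans
  (sum-cong-≗ (λ i → cong (_*₃ b i) (weight-degenerate d p≡0 q≡0 i)))
  (sum-replicate-zero 5)

twist-degenerate : ∀ d → d 0F ≡ 0F → twist d ≡ 0F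
twist-degenerate d p≡0 rewrite p≡0 = 𝔽.zeroʳ (d 2F)

-- Linear combinations, and the twist as an obstruction to linear maps.

comb : ∀ {m n} → Vector (Fin 3) m → Vector (Vector (Fin 3) n) m → Vector (Fin 3) n
comb x w i = sum (λ k → x k *₃ w k i)

comb-zero : ∀ {m n} (x : Vector (Fin 3) m) {w : Vector (Vector (Fin 3) n) m} {i} →
            (∀ k → w k i ≡ 0F) → comb x w i ≡ 0F
comb-zero {m} x w≡0 = trans
  (sum-cong-≗ (λ k → trans (cong (x k *₃_) (w≡0 k)) (𝔽.zeroʳ (x k))))
  (sum-replicate-zero m)

unit : Vector (Vector (Fin 3) 3) 3
unit = (1F ∷ 0F ∷ 0F ∷ []) ∷ (0F ∷ 1F ∷ 0F ∷ []) ∷ (0F ∷ 0F ∷ 1F ∷ []) ∷ []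

comb-unit : ∀ x → comb x unit ≗ x
comb-unit x i = trans (cases (x 0F) (x 1F) (x 2F) i) (η i)
  where
  cases : ∀ p q s → comb (p ∷ q ∷ s ∷ []) unit ≗ (p ∷ q ∷ s ∷ [])
  cases = decide (all? λ p → all? λ q → all? λ s → all? λ i → _ ≟ _)
  η : (x 0F ∷ x 1F ∷ x 2F ∷ []) ≗ x
  η 0F = refl
  η 1F = refl
  η 2F = refl

-- Summing s·F(p,q,s) over all (p,q,s) gives, up to sign, the coefficient of
-- p²q²s in the reduced polynomial F.
twist-not-pairing : ∀ (l : Vector (Vector (Fin 3) 5) 3) →
                    ¬ (∀ d → pairing d (comb d l) ≡ twist d)
-- Here s times the twist is p²q²s², whose sum over all points evaluates to (1+1)³ = 2 in 𝔽₃, not 0.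
twist-not-pairing l pairing≡twist = contradiction sum-twist≡0 (λ ())
  where
  open ≡-Reasoning
  point : Vector (Vector (Fin 3) 3) 27
  point = finToFun

  -- The summand has degree 4. A monomial has nonzero sum over 𝔽₃³ only if all three exponents are
  -- at least 2, hence only in degree 6 or more.
  moment : ∀ i j → sum (λ r → point r 2F *₃ (weight (point r) j *₃ point r i)) ≡ 0F
  moment = decide (all? λ i → all? λ j → _ ≟ _)

  *-comb : ∀ d j → weight d j *₃ comb d l j ≡ sum (λ i → weight d j *₃ d i *₃ l i j)
  *-comb d j = trans (*-distribˡ-sum (weight d j) (λ i → d i *₃ l i j))
    (sum-cong-≗ (λ i → sym (𝔽.*-assoc (weight d j) (d i) (l i j))))

  term : Fin 27 → Fin 3 → Fin 5 → Fin 3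
  term r i j = l i j *₃ (point r 2F *₃ (weight (point r) j *₃ point r i))

  rearrange : ∀ a b c → a *₃ (b *₃ c) ≡ c *₃ (a *₃ b)
  rearrange = decide (all? λ a → all? λ b → all? λ c → _ ≟ _)

  expand : ∀ r → point r 2F *₃ pairing (point r) (comb (point r) l)
               ≡ sum (λ j → sum (λ i → term r i j))
  expand r = trans
    (*-distribˡ-sum (point r 2F) (λ j → weight (point r) j *₃ comb (point r) l j))
    (sum-cong-≗ (λ j → trans
      (cong (point r 2F *₃_) (*-comb (point r) j))
      (trans (*-distribˡ-sum (point r 2F) (λ i → weight (point r) j *₃ point r i *₃ l i j))
        (sum-cong-≗ (λ i → rearrange (point r 2F) (weight (point r) j *₃ point r i) (l i j))))))

  vanish : ∀ j i → sum (λ r → term r i j) ≡ 0F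
  vanish j i = trans
    (sym (*-distribˡ-sum (l i j) (λ r → point r 2F *₃ (weight (point r) j *₃ point r i))))
    (trans (cong (l i j *₃_) (moment i j)) (𝔽.zeroʳ (l i j)))

  sum-twist≡0 : sum (λ r → point r 2F *₃ twist (point r)) ≡ 0F
  sum-twist≡0 = begin
    sum (λ r → point r 2F *₃ twist (point r))
      ≡⟨ sum-cong-≗ (λ r → cong (point r 2F *₃_) (sym (pairing≡twist (point r)))) ⟩
    sum (λ r → point r 2F *₃ pairing (point r) (comb (point r) l))
      ≡⟨ sum-cong-≗ expand ⟩
    sum (λ r → sum (λ j → sum (λ i → term r i j)))
      ≡⟨ ∑-comm (λ r j → sum (λ i → term r i j)) ⟩
    sum (λ j → sum (λ r → sum (λ i → term r i j)))
      ≡⟨ sum-cong-≗ (λ j → ∑-comm (λ r i → term r i j)) ⟩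
    sum (λ j → sum (λ i → sum (λ r → term r i j)))
      ≡⟨ sum-cong-≗ (λ j → trans (sum-cong-≗ (vanish j)) (sum-replicate-zero 3)) ⟩
    sum {5} (λ j → 0F) ≡⟨⟩
    0F ∎

-- Connection sets over the base and fibre decomposition.

base : V.Carrier → Vector (Fin 3) 3
base = take 3

fibre : V.Carrier → Vector (Fin 3) 5
fibre = drop 3

base-cong : ∀ {u v} → u V.≈ v → base u ≗ base v
base-cong u≈v i = u≈v (i ↑ˡ 5)

fibre-cong : ∀ {u v} → u V.≈ v → fibre u ≗ fibre v
fibre-cong u≈v j = u≈v (3 ↑ʳ j)

≗-split : ∀ {u v} → base u ≗ base v → fibre u ≗ fibre v → u V.≈ v
≗-split b f 0F = b 0F
≗-split b f 1F = b 1F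
≗-split b f 2F = b 2F
≗-split b f 3F = f 0F
≗-split b f 4F = f 1F
≗-split b f 5F = f 2F
≗-split b f 6F = f 3F
≗-split b f 7F = f 4F

Degenerate : Pred (Vector (Fin 3) 3) 0ℓ
Degenerate d = d 0F ≡ 0F × d 1F ≡ 0F

Vertical : Pred V.Carrier 0ℓ
Vertical v = base v ≗ 0⃗

-- Oddness makes the connection set inverse-closed: the weights are even in d, so negating a vector
-- negates its pairing, and the offset has to follow.
record Offset : Set where
  field
    value : Vector (Fin 3) 3 → Fin 3
    value-cong : ∀ {d e} → d ≗ e → value d ≡ value e
    value-neg : ∀ d → value (λ i → -₃ d i) ≡ -₃ value d

open Offset

untwisted twisted : Offset
untwisted = record
  { value = λ _ → 0F ; value-cong = λ _ → refl ; value-neg = λ _ → refl }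
twisted = record
  { value = twist
  ; value-cong = twist-cong
  ; value-neg = λ d → cases (d 0F) (d 1F) (d 2F)
  }
  where
  cases : ∀ p q s → twist (-₃ p ∷ -₃ q ∷ -₃ s ∷ []) ≡ -₃ twist (p ∷ q ∷ s ∷ [])
  cases = decide (all? λ p → all? λ q → all? λ s → _ ≟ _)

-- Over d ≠ 0 the fibre of Connected γ is the complement of an affine hyperplane,
-- or empty if weight d = 0 (then γ d = 0 for both offsets above).
module _ (γ : Offset) where

  data Connected (v : V.Carrier) : Set where
    vertical : Vertical v → Connected v
    off      : pairing (base v) (fibre v) ≢ value γ (base v) → Connected v

  Connected-resp : ∀ {u v} → u V.≈ v → Connected u → Connected v
  Connected-resp {u} {v} u≈v (vertical u-vertical) =
    vertical (λ i → trans (sym (base-cong u≈v i)) (u-vertical i))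
  Connected-resp {u} {v} u≈v (off ≢γ) = off (λ ≡γ → ≢γ (trans
    (pairing-cong (base u) (base v) (base-cong u≈v) (fibre-cong u≈v))
    (trans ≡γ (sym (value-cong γ (base-cong u≈v))))))

  Connected-⁻¹ : ∀ v → Connected v → Connected (v V.⁻¹)
  Connected-⁻¹ v (vertical v-vertical) = vertical (λ i → cong -₃_ (v-vertical i))
  Connected-⁻¹ v (off ≢γ) = off (λ ≡γ → ≢γ (𝔽.⁻¹-injective (begin
    -₃ pairing (base v) (fibre v)
      ≡⟨ pairing-neg (base v) (fibre v) ⟨
    pairing (base v) (fibre (v V.⁻¹))
      ≡⟨ sum-cong-≗ (λ i → cong (_*₃ fibre (v V.⁻¹) i) (weight-neg (base v) i)) ⟩
    pairing (base (v V.⁻¹)) (fibre (v V.⁻¹))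
      ≡⟨ ≡γ ⟩
    value γ (base (v V.⁻¹))
      ≡⟨ value-neg γ (base v) ⟩
    -₃ value γ (base v) ∎)))
    where
    open ≡-Reasoning
    weight-neg : ∀ d → weight d ≗ weight (λ i → -₃ d i)
    weight-neg d i = cases (d 0F) (d 1F) (d 2F) i
      where
      cases : ∀ p q s → weight (p ∷ q ∷ s ∷ []) ≗ weight (-₃ p ∷ -₃ q ∷ -₃ s ∷ [])
      cases = decide (all? λ p → all? λ q → all? λ s → all? λ i → _ ≟ _)

  connection : ConnectionSet (ℤ₃^ 8)
  connection = record
    { set = Connected
    ; respects = Connected-resp
    ; inverse-closed =
        (λ {v} v∈ → v V.⁻¹ , Connected-⁻¹ v v∈ , VP.⁻¹-involutive v)
      , λ { (u , u∈ , u⁻¹≈v) → Connected-resp u⁻¹≈v (Connected-⁻¹ u u∈) }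
    }

  -- The two entries `r` meet the weights q² and p², so the pairing is (p²+q²)r. As -1 is not a
  -- square mod 3, p²+q² squares to 1 for (p,q) ≠ 0, and the pairing exceeds the offset by 1.
  sample : Vector (Fin 3) 3 → V.Carrier
  sample d = d ++ (0F ∷ 0F ∷ r ∷ 0F ∷ r ∷ [])
    where r = (d 0F *₃ d 0F +₃ d 1F *₃ d 1F) *₃ (value γ d +₃ 1F)

  sample-connected : ∀ d → ¬ Degenerate d → Connected (sample d)
  sample-connected d ¬degenerate = off λ ≡γ →
    cases (d 0F) (d 1F) (d 2F) (value γ d) ¬degenerate
      (trans ≡γ (value-cong γ {e = d} (λ { 0F → refl ; 1F → refl ; 2F → refl })))
    where
    cases : ∀ p q s g → ¬ (p ≡ 0F × q ≡ 0F) →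
      let r = (p *₃ p +₃ q *₃ q) *₃ (g +₃ 1F) in
      pairing (p ∷ q ∷ s ∷ []) (0F ∷ 0F ∷ r ∷ 0F ∷ r ∷ []) ≢ g
    cases = decide (all? λ p → all? λ q → all? λ s → all? λ g →
      ¬? ((p ≟ 0F) ×-dec (q ≟ 0F)) →-dec ¬? (_ ≟ _))

  nondegenerate-generated : ∀ v → ¬ Degenerate (base v) → v ∈ ⟨_⟩ (ℤ₃^ 8) Connected
  nondegenerate-generated v ¬degenerate =
    ∙-gen (sample-connected (base v) ¬degenerate)
      (∙-gen {x = rest} (vertical rest-vertical) ε-gen (V.identityʳ rest))
      (VP.\\-leftDividesˡ (sample (base v)) v)
    where
    rest : V.Carrier
    rest = sample (base v) V.⁻¹ V.∙ v

    rest-vertical : Vertical rest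
    rest-vertical i = trans
      (cong (λ x → (-₃ x) +₃ base v i) (lookup-++ˡ (base v) _ i))
      (𝔽.-‿inverseˡ (base v i))

  generates : Generates (ℤ₃^ 8) connection
  generates v with (base v 0F ≟ 0F) ×-dec (base v 1F ≟ 0F)
  ... | no ¬degenerate = nondegenerate-generated v ¬degenerate
  ... | yes (p≡0 , _) =
    -- Splitting off a sample over (1,0,0) changes the first coordinate from 0 to 2 and so leaves a
    -- nondegenerate vector.
    ∙-gen (sample-connected (unit 0F) (λ { (() , _) }))
      (nondegenerate-generated (sample (unit 0F) V.⁻¹ V.∙ v)
        (λ (2+p≡0 , _) → contradiction (trans (sym 2+p≡0) (cong (2F +₃_) p≡0)) (λ ())))
      (VP.\\-leftDividesˡ (sample (unit 0F)) v)

-- Recognising vertical vectors from the connection set.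

S T : ConnectionSet (ℤ₃^ 8)
S = connection untwisted
T = connection twisted

-- A property that automorphisms mapping S onto T transport, and that singles out
-- the vertical vectors.
Absorbs : Pred V.Carrier 0ℓ → Pred V.Carrier 0ℓ
Absorbs X v = ∀ {u} → u ∈ X → u V.∙ v ∈ X ⊎ u V.∙ v V.⁻¹ ∈ X

-- Adding ±v fixes the base of u and moves its pairing x to x ± y. If both equalled the offset g,
-- their sum would give 2x = 2g, hence x = g.
vertical⇒absorbs : ∀ γ {v} → Vertical v → Absorbs (Connected γ) v
vertical⇒absorbs γ v-vertical (vertical u-vertical) =
  inj₁ (vertical (λ i → cong₂ _+₃_ (u-vertical i) (v-vertical i)))
vertical⇒absorbs γ {v} v-vertical {u} (off ≢γ) =
  Sum.map
    (λ x+y≢γ → off λ ≡γ → x+y≢γ (trans (shifted v base-u) (trans ≡γ (value-cong γ base-u))))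
    (λ x-y≢γ → off λ ≡γ → x-y≢γ (trans
      (trans (cong (pairing (base u) (fibre u) +₃_) (sym (pairing-neg (base u) (fibre v))))
        (shifted (v V.⁻¹) base-u′))
      (trans ≡γ (value-cong γ base-u′))))
    (cases (pairing (base u) (fibre u)) (pairing (base u) (fibre v)) (value γ (base u)) ≢γ)
  where
  cases : ∀ x y g → x ≢ g → (x +₃ y ≢ g) ⊎ (x +₃ (-₃ y) ≢ g)
  cases = decide (all? λ x → all? λ y → all? λ g →
    ¬? (x ≟ g) →-dec (¬? (x +₃ y ≟ g) ⊎-dec ¬? (x +₃ (-₃ y) ≟ g)))

  base-u : base (u V.∙ v) ≗ base u
  base-u i = trans (cong (base u i +₃_) (v-vertical i)) (𝔽.+-identityʳ (base u i))

  base-u′ : base (u V.∙ v V.⁻¹) ≗ base u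
  base-u′ i = trans (cong (λ x → base u i +₃ (-₃ x)) (v-vertical i)) (𝔽.+-identityʳ (base u i))

  shifted : ∀ w → base (u V.∙ w) ≗ base u →
    pairing (base u) (fibre u) +₃ pairing (base u) (fibre w)
    ≡ pairing (base (u V.∙ w)) (fibre (u V.∙ w))
  shifted w base-eq = trans (sym (pairing-+ (base u) (fibre u) (fibre w)))
    (pairing-cong (base u) (base (u V.∙ w)) {b = fibre (u V.∙ w)}
      (λ i → sym (base-eq i)) (λ i → refl))

-- On the line p = q = 0 the pairing and the twist both vanish, so `off` cannot apply.
degenerate∉T : ∀ {v} → Degenerate (base v) → ¬ Vertical v → v ∉ set T
degenerate∉T _ ¬vertical (vertical v-vertical) = ¬vertical v-vertical
degenerate∉T {v} (p≡0 , q≡0) _ (off ≢twist) = ≢twist (trans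
  (pairing-degenerate (base v) (fibre v) p≡0 q≡0)
  (sym (twist-degenerate (base v) p≡0)))

-- probe d x lies in the fibre over d + d + (0,0,1), where it violates membership
-- in T, while its pairing with d + (0,0,1) is 1 + x + twist (d + (0,0,1)).
-- Both values can be prescribed because the weights at these two points differ
-- by a nonzero vector in the first two coordinates when d is not degenerate.
probe : Vector (Fin 3) 3 → Fin 3 → Vector (Fin 3) 5
probe d x = n *₃ q *₃ z ∷ n *₃ p *₃ z ∷ n *₃ r ∷ 0F ∷ n *₃ r ∷ []
  where
  p = d 0F; q = d 1F; s = d 2F
  n = p *₃ p +₃ q *₃ q
  y = twist ((p +₃ p) ∷ (q +₃ q) ∷ ((s +₃ 1F) +₃ s) ∷ [])
  z = ((1F +₃ x) +₃ twist (p ∷ q ∷ (s +₃ 1F) ∷ [])) +₃ (-₃ y)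
  -- Off the degenerate line n² = 1, so the pairing with the probe is (2s+1)z + r = y at d + d +
  -- (0,0,1) and -(s+1)z + r = y + z at d + (0,0,1).
  r = y +₃ (s +₃ 2F) *₃ z

-- If `base v` is degenerate and nonzero, absorption already fails at u = 0. Otherwise it fails at a
-- vector t over `base v` + (0,0,1): t - v lies over (0,0,1), where `T` is empty, and t + v has the
-- fibre `probe`, which keeps it out of `T`.
absorbs⇒vertical : ∀ {v} → Absorbs (set T) v → Vertical v
absorbs⇒vertical {v} absorbs with all? (λ i → base v i ≟ 0F)
... | yes v-vertical = v-vertical
... | no ¬vertical with (base v 0F ≟ 0F) ×-dec (base v 1F ≟ 0F)
... | yes degenerate = contradiction v∈T (degenerate∉T degenerate ¬vertical)
  where
  v∈T : v ∈ set T
  v∈T = [ Connected-resp twisted (V.identityˡ v)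
        , Connected-resp twisted (V.trans (V.⁻¹-cong (V.identityˡ (v V.⁻¹))) (VP.⁻¹-involutive v))
          ∘ Connected-⁻¹ twisted (V.ε V.∙ v V.⁻¹)
        ]′ (absorbs {V.ε} (vertical (λ _ → refl)))
... | no ¬degenerate = contradiction (absorbs t∈T) [ t+v∉T , t-v∉T ]′
  where
  d d⁺ : Vector (Fin 3) 3
  d = base v
  d⁺ i = d i +₃ unit 2F i

  x : Fin 3
  x = pairing d⁺ (fibre v)

  t-fibre : Vector (Fin 3) 5
  t-fibre j = (-₃ fibre v j) +₃ probe d x j

  t : V.Carrier
  t = d⁺ ++ t-fibre

  t∈T : t ∈ set T
  -- The pairing of t is -x + (1 + x + twist), one more than the twist at `d⁺`.
  t∈T = off λ ≡twist → cases (d 0F) (d 1F) (d 2F) x ¬degenerate (trans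
    (sym (trans (pairing-+ d⁺ (λ j → -₃ fibre v j) (probe d x))
                (cong (_+₃ pairing d⁺ (probe d x)) (pairing-neg d⁺ (fibre v)))))
    ≡twist)
    where
    cases : ∀ p q s x → ¬ (p ≡ 0F × q ≡ 0F) →
      let d = p ∷ q ∷ s ∷ []; d⁺ = λ i → d i +₃ unit 2F i in
      (-₃ x) +₃ pairing d⁺ (probe d x) ≢ twist d⁺
    cases = decide (all? λ p → all? λ q → all? λ s → all? λ x →
      ¬? ((p ≟ 0F) ×-dec (q ≟ 0F)) →-dec ¬? (_ ≟ _))

  t+v∉T : t V.∙ v ∉ set T
  t+v∉T (vertical tv-vertical) =
    ¬degenerate (halve (d 0F) (tv-vertical 0F) , halve (d 1F) (tv-vertical 1F))
    where
    halve : ∀ p → (p +₃ 0F) +₃ p ≡ 0F → p ≡ 0F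
    halve = decide (all? λ p → (_ ≟ _) →-dec (_ ≟ _))
  t+v∉T (off ≢twist) = ≢twist (trans
    (pairing-cong (base (t V.∙ v)) (base (t V.∙ v)) {b = fibre (t V.∙ v)} {c = probe d x}
      (λ i → refl)
      (λ j → trans (cong (_+₃ fibre v j) (lookup-++ʳ d⁺ t-fibre j))
                   (cancel (fibre v j) (probe d x j))))
    (cases (d 0F) (d 1F) (d 2F) x ¬degenerate))
    where
    cancel : ∀ b c → ((-₃ b) +₃ c) +₃ b ≡ c
    cancel = decide (all? λ b → all? λ c → _ ≟ _)

    cases : ∀ p q s x → ¬ (p ≡ 0F × q ≡ 0F) →
      let d = p ∷ q ∷ s ∷ []; d⁺⁺ = λ i → (d i +₃ unit 2F i) +₃ d i in
      pairing d⁺⁺ (probe d x) ≡ twist d⁺⁺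
    cases = decide (all? λ p → all? λ q → all? λ s → all? λ x →
      ¬? ((p ≟ 0F) ×-dec (q ≟ 0F)) →-dec (_ ≟ _))

  t-v∉T : t V.∙ v V.⁻¹ ∉ set T
  t-v∉T = degenerate∉T (cancel (d 0F) , cancel (d 1F))
    (λ tv-vertical → cancel′ (d 2F) (tv-vertical 2F))
    where
    cancel : ∀ p → (p +₃ 0F) +₃ (-₃ p) ≡ 0F
    cancel = decide (all? λ p → _ ≟ _)

    cancel′ : ∀ s → (s +₃ 1F) +₃ (-₃ s) ≢ 0F
    cancel′ = decide (all? λ s → ¬? (_ ≟ _))

-- The isomorphism between the two Cayley graphs.

T≅S : Cay (ℤ₃^ 8) T ≅ Cay (ℤ₃^ 8) S
T≅S = record
  { bijection = record
    { to        = untwist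
    ; from      = retwist
    ; to-cong   = untwist-cong
    ; from-cong = retwist-cong
    ; inverse   =
        Consequences.strictlyInverseˡ⇒inverseˡ V.setoid V.setoid untwist-cong untwist-retwist
      , Consequences.strictlyInverseʳ⇒inverseʳ V.setoid V.setoid retwist-cong retwist-untwist
    }
  ; adjacency = adjacency
  }
  where
  untwisted-fibre retwisted-fibre : V.Carrier → Vector (Fin 3) 5
  untwisted-fibre v j = fibre v j +₃ (-₃ cubics (base v) j)
  retwisted-fibre v j = fibre v j +₃ cubics (base v) j

  untwist retwist : V.Carrier → V.Carrier
  untwist v = base v ++ untwisted-fibre v
  retwist v = base v ++ retwisted-fibre v

  base-untwist : ∀ v → base (untwist v) ≗ base v
  base-untwist v = lookup-++ˡ (base v) (untwisted-fibre v)

  base-retwist : ∀ v → base (retwist v) ≗ base v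
  base-retwist v = lookup-++ˡ (base v) (retwisted-fibre v)

  fibre-untwist : ∀ v → fibre (untwist v) ≗ untwisted-fibre v
  fibre-untwist v = lookup-++ʳ (base v) (untwisted-fibre v)

  fibre-retwist : ∀ v → fibre (retwist v) ≗ retwisted-fibre v
  fibre-retwist v = lookup-++ʳ (base v) (retwisted-fibre v)

  untwist-cong : ∀ {u v} → u V.≈ v → untwist u V.≈ untwist v
  untwist-cong {u} {v} u≈v = ≗-split
    (λ i → trans (base-untwist u i) (trans (base-cong u≈v i) (sym (base-untwist v i))))
    (λ j → trans (fibre-untwist u j) (trans
      (cong₂ (λ x y → x +₃ (-₃ y)) (fibre-cong u≈v j) (cubics-cong (base-cong u≈v) j))
      (sym (fibre-untwist v j))))

  retwist-cong : ∀ {u v} → u V.≈ v → retwist u V.≈ retwist v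
  retwist-cong {u} {v} u≈v = ≗-split
    (λ i → trans (base-retwist u i) (trans (base-cong u≈v i) (sym (base-retwist v i))))
    (λ j → trans (fibre-retwist u j) (trans
      (cong₂ _+₃_ (fibre-cong u≈v j) (cubics-cong (base-cong u≈v) j))
      (sym (fibre-retwist v j))))

  untwist-retwist : ∀ v → untwist (retwist v) V.≈ v
  untwist-retwist v = ≗-split
    (λ i → trans (base-untwist (retwist v) i) (base-retwist v i))
    (λ j → trans (fibre-untwist (retwist v) j) (trans
      (cong₂ (λ x y → x +₃ (-₃ y)) (fibre-retwist v j) (cubics-cong (base-retwist v) j))
      (𝔽.//-rightDividesʳ (cubics (base v) j) (fibre v j))))

  retwist-untwist : ∀ v → retwist (untwist v) V.≈ v
  retwist-untwist v = ≗-split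
    (λ i → trans (base-retwist (untwist v) i) (base-untwist v i))
    (λ j → trans (fibre-retwist (untwist v) j) (trans
      (cong₂ _+₃_ (fibre-untwist v j) (cubics-cong (base-untwist v) j))
      (𝔽.//-rightDividesˡ (cubics (base v) j) (fibre v j))))

  adjacency : ∀ u v → v V.∙ u V.⁻¹ ∈ set T ⇔ untwist v V.∙ untwist u V.⁻¹ ∈ set S
  adjacency u v = mk⇔
    (λ { (vertical w-vertical) → vertical (λ i → trans (base-difference i) (w-vertical i))
       ; (off ≢twist) → off (λ ≡0 → ≢twist (trans untwisted-pairing
           (trans (cong (_+₃ twist (base w)) ≡0) (𝔽.+-identityˡ _)))) })
    (λ { (vertical w′-vertical) → vertical (λ i → trans (sym (base-difference i)) (w′-vertical i))
       ; (off ≢0) → off (λ ≡twist →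
           ≢0 (𝔽.identityˡ-unique _ _ (trans (sym untwisted-pairing) ≡twist))) })
    where
    w w′ : V.Carrier
    w = v V.∙ u V.⁻¹
    w′ = untwist v V.∙ untwist u V.⁻¹

    cubics-difference : Vector (Fin 3) 5
    cubics-difference j = cubics (base v) j +₃ (-₃ cubics (base u) j)

    base-difference : base w′ ≗ base w
    base-difference i = cong₂ (λ x y → x +₃ (-₃ y)) (base-untwist v i) (base-untwist u i)

    rearrange : ∀ a b c d → a +₃ (-₃ b) ≡ ((a +₃ (-₃ c)) +₃ (-₃ (b +₃ (-₃ d)))) +₃ (c +₃ (-₃ d))
    rearrange = decide (all? λ a → all? λ b → all? λ c → all? λ d → _ ≟ _)

    open ≡-Reasoning

    -- `fibre w` is `fibre w′` plus `cubics-difference`, and by `pairing-cubics` the latter pairs to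
    -- a value depending only on `base w`.
    untwisted-pairing : pairing (base w) (fibre w) ≡ pairing (base w′) (fibre w′) +₃ twist (base w)
    untwisted-pairing = begin
      pairing (base w) (fibre w)
        ≡⟨ pairing-cong (base w) (base w′) {b = fibre w}
             (λ i → sym (base-difference i)) (λ j → trans
             (rearrange (fibre v j) (fibre u j) (cubics (base v) j) (cubics (base u) j))
             (cong (_+₃ cubics-difference j)
               (sym (cong₂ (λ x y → x +₃ (-₃ y)) (fibre-untwist v j) (fibre-untwist u j))))) ⟩
      pairing (base w′) (λ j → fibre w′ j +₃ cubics-difference j)
        ≡⟨ pairing-+ (base w′) (fibre w′) cubics-difference ⟩
      pairing (base w′) (fibre w′) +₃ pairing (base w′) cubics-difference
        ≡⟨ cong (pairing (base w′) (fibre w′) +₃_) (trans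
             (pairing-cong (base w′) (base w) {b = cubics-difference} base-difference (λ _ → refl))
             (pairing-cubics (base v) (base u))) ⟩
      pairing (base w′) (fibre w′) +₃ twist (base w) ∎

-- No automorphism carries one connection set to the other.

no-automorphism : ∀ {β} → IsGroupIsomorphism V.rawGroup V.rawGroup β →
                  ¬ (image (ℤ₃^ 8) β (set S) ≐ set T)
no-automorphism {β} β-iso (βS⊆T , T⊆βS) = twist-not-pairing l pairing≡twist
  where
  module β = GroupMorphisms.IsGroupIsomorphism β-iso

  reflects : ∀ {v} → β v ∈ set T → v ∈ set S
  reflects βv∈T =
    let s , s∈S , βs≈βv = T⊆βS βv∈T in respects S (β.injective βs≈βv) s∈S

  absorbs : ∀ {v} → Absorbs (set S) v → Absorbs (set T) (β v)
  absorbs {v} S-absorbs {t} t∈T =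
    let s , s∈S , βs≈t = T⊆βS t∈T in
    Sum.map
      (λ sv∈S → βS⊆T (_ , sv∈S , V.trans (β.∙-homo s v) (V.∙-congʳ βs≈t)))
      (λ sv⁻¹∈S → βS⊆T (_ , sv⁻¹∈S , V.trans (β.∙-homo s (v V.⁻¹)) (V.∙-cong βs≈t (β.⁻¹-homo v))))
      (S-absorbs s∈S)

  β-vertical : ∀ {v} → Vertical v → Vertical (β v)
  β-vertical v-vertical =
    absorbs⇒vertical (absorbs (vertical⇒absorbs untwisted v-vertical))

  -- Additivity gives linearity over 𝔽₃, whose scalars are 0, 1 and 1 + 1.
  β-scale : ∀ x v → β (λ i → x *₃ v i) V.≈ (λ i → x *₃ β v i)
  β-scale 0F v = β.ε-homo
  β-scale 1F v i = trans (β.⟦⟧-cong (λ k → 𝔽.*-identityˡ (v k)) i) (sym (𝔽.*-identityˡ (β v i)))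
  β-scale 2F v i = trans (β.⟦⟧-cong (λ k → double (v k)) i)
    (trans (β.∙-homo v v i) (sym (double (β v i))))
    where
    double : ∀ x → 2F *₃ x ≡ x +₃ x
    double = decide (all? λ x → _ ≟ _)

  β-comb : ∀ {m} (x : Vector (Fin 3) m) w → β (comb x w) V.≈ comb x (β ∘ w)
  β-comb {zero}  x w = β.ε-homo
  β-comb {suc m} x w i = trans (β.∙-homo (λ i → x 0F *₃ w 0F i) (comb (x ∘ suc) (w ∘ suc)) i)
    (cong₂ _+₃_ (β-scale (x 0F) (w 0F) i) (β-comb (x ∘ suc) (w ∘ suc) i))

  -- `horizontal k` is a preimage of the k-th unit vector with its fibre erased. The erased part is
  -- vertical and `β` keeps it vertical, so the image still has base `unit k`.
  preimage horizontal : Vector V.Carrier 3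
  preimage k = proj₁ (β.surjective (unit k ++ 0⃗))
  horizontal k = base (preimage k) ++ 0⃗

  l : Vector (Vector (Fin 3) 5) 3
  l k = fibre (β (horizontal k))

  base-β-horizontal : ∀ k → base (β (horizontal k)) ≗ unit k
  base-β-horizontal k i = trans
    (𝔽.x∙y⁻¹≈ε⇒x≈y _ _ (trans (sym difference) (β-vertical d-vertical i)))
    (trans (proj₂ (β.surjective (unit k ++ 0⃗)) V.refl _) (lookup-++ˡ (unit k) _ i))
    where
    d-vertical : Vertical (horizontal k V.∙ preimage k V.⁻¹)
    d-vertical i = trans
      (cong (_+₃ (-₃ base (preimage k) i)) (lookup-++ˡ (base (preimage k)) _ i))
      (𝔽.-‿inverseʳ (base (preimage k) i))

    difference : base (β (horizontal k V.∙ preimage k V.⁻¹)) i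
               ≡ base (β (horizontal k)) i +₃ (-₃ base (β (preimage k)) i)
    difference = trans (β.∙-homo (horizontal k) (preimage k V.⁻¹) (i ↑ˡ 5))
      (cong (base (β (horizontal k)) i +₃_) (β.⁻¹-homo (preimage k) (i ↑ˡ 5)))

  pairing≡twist : ∀ x → pairing x (comb x l) ≡ twist x
  -- If the values differed, `β u` would lie in `T`, so `u` in `S`. Since `u` has fibre 0 and
  -- pairing 0, its base must vanish; then `u`, `β u` and x are 0 and both values vanish.
  pairing≡twist x = decidable-stable (_ ≟ _) λ ≢twist → case (reflects (off λ ≡twist →
    ≢twist (trans (pairing-cong x (base (β u)) {b = comb x l}
      (λ i → sym (base-βu i)) (λ j → sym (β-comb x horizontal (3 ↑ʳ j))))
      (trans ≡twist (twist-cong base-βu))))) ≢twist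
    where
    u : V.Carrier
    u = comb x horizontal

    base-βu : base (β u) ≗ x
    base-βu i = trans (β-comb x horizontal (i ↑ˡ 5)) (trans
      (sum-cong-≗ (λ k → cong (x k *₃_) (base-β-horizontal k i)))
      (comb-unit x i))

    fibre-u : fibre u ≗ 0⃗
    fibre-u j = comb-zero x {horizontal} {3 ↑ʳ j} (λ k → lookup-++ʳ (base (preimage k)) 0⃗ j)

    case : u ∈ set S → ¬ (pairing x (comb x l) ≢ twist x)
    case (off ≢0) _ = ≢0 (pairing-zero (base u) fibre-u)
    case (vertical u-vertical) ≢twist = ≢twist (trans
      (pairing-degenerate x (comb x l) (x≗0 0F) (x≗0 1F))
      (sym (twist-degenerate x (x≗0 0F))))
      where
      x≗0 : x ≗ 0⃗
      x≗0 i = trans (sym (base-βu i)) (V.trans (β.⟦⟧-cong (≗-split u-vertical fibre-u)) β.ε-homo _)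

-- Transversals of finite groups

-- The type promises some witness, but the value is the smallest one, as `least-cong` requires.
least : ∀ {n p} {P : Pred (Fin n) p} → Decidable P → ∃ P → ∃ P
least {suc n} P? (i , Pi) with P? zero | i
... | yes P0 | _ = zero , P0
... | no ¬P0 | zero = contradiction Pi ¬P0
... | no ¬P0 | suc j = Product.map suc id (least (P? ∘ suc) (j , Pi))

-- The minimum depends on the set alone, not on the starting witness, so it can serve as a canonical
-- choice in a coset.
least-cong : ∀ {n p q} {P : Pred (Fin n) p} {Q : Pred (Fin n) q} →
             (P? : Decidable P) (Q? : Decidable Q) → P ⊆ Q → Q ⊆ P → ∀ i j →
             proj₁ (least P? i) ≡ proj₁ (least Q? j)
least-cong {suc n} P? Q? P⊆Q Q⊆P (i , Pi) (j , Qj) with P? zero | i | Q? zero | j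
... | yes P0 | _ | yes Q0 | _ = refl
... | yes P0 | _ | no ¬Q0 | _ = contradiction (P⊆Q P0) ¬Q0
... | no ¬P0 | _ | yes Q0 | _ = contradiction (Q⊆P Q0) ¬P0
... | no ¬P0 | zero | no ¬Q0 | _ = contradiction Pi ¬P0
... | no ¬P0 | suc i | no ¬Q0 | zero = contradiction Qj ¬Q0
... | no ¬P0 | suc i | no ¬Q0 | suc j =
  cong suc (least-cong (P? ∘ suc) (Q? ∘ suc) P⊆Q Q⊆P (i , Pi) (j , Qj))

module _ {c ℓ} (K : Group 0ℓ 0ℓ) (G : Group c ℓ) {f}
  (f-mono : IsGroupMonomorphism (Group.rawGroup K) (Group.rawGroup G) f)
  where

  open Extension K G f f-mono
  private
    module G = Group G
    module f = GroupMorphisms.IsGroupMonomorphism f-mono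

  -- Enumerating `K` and `G` makes `_∼_` decidable; the representative is the coset member of
  -- smallest index.
  finite-transversal : IsFinite K → IsFinite G → ∃ IsTransversal
  finite-transversal (_ , K↔Fin) (_ , G↔Fin) = rep , rep∼ , rep-respects
    where
    module K↔ = Inverse K↔Fin
    module G↔ = Inverse G↔Fin

    _≈?_ : ∀ x y → Dec (x G.≈ y)
    x ≈? y = map′
      (λ tx≡ty → G.trans (G.sym (G↔.inverseʳ refl)) (G↔.inverseʳ tx≡ty))
      G↔.to-cong (G↔.to x ≟ G↔.to y)

    _∼?_ : ∀ x y → Dec (x ∼ y)
    x ∼? y = map′
      (λ (j , eq) → K↔.from j , eq)
      (λ (k , eq) → K↔.to k , G.trans (G.∙-congʳ (f.⟦⟧-cong (K↔.inverseʳ refl))) eq)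
      (any? λ j → (f (K↔.from j) G.∙ x) ≈? y)

    self : ∀ x → ∃ λ i → G↔.from i ∼ x
    self x = G↔.to x , ∼-reflexive (G↔.inverseʳ refl)

    first : ∀ x → ∃ λ i → G↔.from i ∼ x
    first x = least (λ i → G↔.from i ∼? x) (self x)

    rep : G.Carrier → G.Carrier
    rep x = G↔.from (proj₁ (first x))

    rep∼ : ∀ x → rep x ∼ x
    rep∼ x = proj₂ (first x)

    rep-respects : ∀ {x y} → x ∼ y → rep x G.≈ rep y
    rep-respects {x} {y} x∼y = G.reflexive (cong G↔.from (least-cong
      (λ i → G↔.from i ∼? x) (λ i → G↔.from i ∼? y)
      (λ i∼x → ∼-trans i∼x x∼y) (λ i∼y → ∼-trans i∼y (∼-sym x∼y))
      (self x) (self y)))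

-- Finiteness and padding for powers of ℤ₃.

ℤ₃^-finite : ∀ n → IsFinite (ℤ₃^ n)
ℤ₃^-finite n = 3 ^ n , record
  { to = funToFin
  ; from = finToFun
  ; to-cong = funToFin-cong
  ; from-cong = λ { refl _ → refl }
  ; inverse = (λ {i} v≗i → trans (funToFin-cong v≗i) (funToFin-finToFin {n} i))
            , λ { {v} refl → finToFun-funToFin v }
  }
  where
  funToFin-cong : ∀ {n} {u v : Vector (Fin 3) n} → (∀ i → u i ≡ v i) → funToFin u ≡ funToFin v
  funToFin-cong {zero}  u≗v = refl
  funToFin-cong {suc n} u≗v = cong₂ combine (u≗v zero) (funToFin-cong (u≗v ∘ suc))

pad-mono : ∀ m n → IsGroupMonomorphism
  (Group.rawGroup (ℤ₃^ m)) (Group.rawGroup (ℤ₃^ (m + n))) (_++ λ (_ : Fin n) → zero)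
pad-mono m n = record
  { isGroupHomomorphism = record
    { isMonoidHomomorphism = record
      { isMagmaHomomorphism = record
        { isRelHomomorphism = record { cong = λ u≗v i → pad-cong u≗v (splitAt m i) }
        ; homo = λ u v i → pad-homo u v (splitAt m i)
        }
      ; ε-homo = λ i → pad-ε (splitAt m i)
      }
    ; ⁻¹-homo = λ v i → pad-⁻¹ v (splitAt m i)
    }
  ; injective = λ {u} {v} eq i →
      trans (sym (lookup-++ˡ u _ i)) (trans (eq (i ↑ˡ n)) (lookup-++ˡ v _ i))
  }
  where
  -- `_++_` dispatches on `splitAt m i`; abstracting that value lets each law be checked by cases.
  pad : Vector (Fin 3) m → _
  pad v = [ v , (λ (_ : Fin n) → zero) ]′

  pad-cong : ∀ {u v} → (∀ i → u i ≡ v i) → ∀ k → pad u k ≡ pad v k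
  pad-cong u≗v (inj₁ i) = u≗v i
  pad-cong u≗v (inj₂ _) = refl

  pad-homo : ∀ u v k → pad (λ i → u i +₃ v i) k ≡ (pad u k +₃ pad v k)
  pad-homo u v (inj₁ _) = refl
  pad-homo u v (inj₂ _) = refl

  pad-ε : ∀ k → pad (λ _ → zero) k ≡ zero
  pad-ε (inj₁ _) = refl
  pad-ε (inj₂ _) = refl

  pad-⁻¹ : ∀ v k → pad (λ i → -₃ v i) k ≡ -₃ pad v k
  pad-⁻¹ v (inj₁ _) = refl
  pad-⁻¹ v (inj₂ _) = refl

-- Transfer to overgroups.

module _ {c ℓ} {G : Group c ℓ} {f}
  (f-mono : IsGroupMonomorphism (Group.rawGroup (ℤ₃^ 8)) (Group.rawGroup G) f)
  where

  open Extension (ℤ₃^ 8) G f f-mono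

  ¬CI-transversal : ∃ IsTransversal → ¬ IsCIGroup G
  ¬CI-transversal (_ , transversal) ci =
    let β , β-iso , βS≐T = CI-restriction transversal ci {S} {T}
                             (generates untwisted) (generates twisted) T≅S
    in no-automorphism β-iso βS≐T

  ¬CI-finite : IsFinite G → ¬ IsCIGroup G
  ¬CI-finite fin =
    ¬CI-transversal (finite-transversal (ℤ₃^ 8) G f-mono (ℤ₃^-finite 8) fin)

  ¬CI-choice : AxiomOfChoice c ℓ → ¬ IsCIGroup G
  ¬CI-choice choice =
    let rep , rep∼ , rep-respects = choice cosets
    in ¬CI-transversal (rep , rep∼ , λ x∼y → Group.reflexive G (rep-respects x∼y))

-- A subgroup takes its equality and operations from `G`, so the laws of the isomorphism carry over
-- unchanged.
inclusion-mono : ∀ {a b c ℓ} {K : Group a b} {G : Group c ℓ} →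
  (K≤G : HasSubgroupIsomorphicTo K G) → let _ , f , _ = K≤G in
  IsGroupMonomorphism (Group.rawGroup K) (Group.rawGroup G) (proj₁ ∘ f)
inclusion-mono (_ , _ , f-iso) = record
  { isGroupHomomorphism = record
    { isMonoidHomomorphism = record
      { isMagmaHomomorphism = record
        { isRelHomomorphism = record { cong = f.⟦⟧-cong }
        ; homo = f.∙-homo
        }
      ; ε-homo = f.ε-homo
      }
    ; ⁻¹-homo = f.⁻¹-homo
    }
  ; injective = f.injective
  }
  where module f = GroupMorphisms.IsGroupIsomorphism f-iso

ℤ₃^-¬CI : ∀ n → n ≥ 8 → ¬ IsCIGroup (ℤ₃^ n)
ℤ₃^-¬CI n n≥8 = subst (λ k → ¬ IsCIGroup (ℤ₃^ k)) (m+[n∸m]≡n n≥8)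
  (¬CI-finite (pad-mono 8 (n ∸ 8)) (ℤ₃^-finite (8 + (n ∸ 8))))

theorem3p11 : ∀ {c ℓ} →
    ¬ IsCIGroup (ℤ₃^ 8)
    × (∀ (G : Group c ℓ) → HasSubgroupIsomorphicTo (ℤ₃^ 8) G → IsFinite G → ¬ IsCIGroup G)
    × (AxiomOfChoice c ℓ → ∀ (G : Group c ℓ) → HasSubgroupIsomorphicTo (ℤ₃^ 8) G → ¬ IsCIGroup G)
    × (∀ n → n ≥ 8 → ¬ IsCIGroup (ℤ₃^ n))
theorem3p11 =
    ℤ₃^-¬CI 8 ≤-refl
  , (λ G V≤G → ¬CI-finite (inclusion-mono {K = ℤ₃^ 8} {G} V≤G))
  , (λ choice G V≤G → ¬CI-choice (inclusion-mono {K = ℤ₃^ 8} {G} V≤G) choice)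
  , ℤ₃^-¬CI
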